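{- There exists a simple $2$-$(55,10,4)$ design.
   Context: A $t$-$(v,k,\lambda)$ design consists of a $v$-element set $P$ of points together with a collection $B$ of $k$-element subsets of $P$ (called blocks) such that every $t$-element subset of $P$ is contained in exactly $\lambda$ blocks. The design is simple if $B$ is a set, i.e. contains no repeated blocks. -}

module Defs where

open import Data.Nat using (ℕ)
open import Data.Fin.Subset using (Subset; ∣_∣; _⊆_)
open import Data.Fin.Subset.Properties using (_⊆?_)
open import Data.List using (List; filter; length)
open import Data.List.Relation.Unary.All using (All)
open import Data.List.Relation.Unary.Unique.Propositional using (Unique)
open import Data.Product using (_×_)
open import Relation.Binary.PropositionalEquality using (_≡_)

-- Point set P = Fin v; a block is a subset of Fin v (Subset v = Vec Bool v).
-- The block collection B is a list (a finite multiset of blocks).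

count : {v : ℕ} → Subset v → List (Subset v) → ℕ
count T B = length (filter (T ⊆?_) B)

IsDesign : (t v k λ′ : ℕ) → List (Subset v) → Set
IsDesign t v k λ′ B =
  All (λ b → ∣ b ∣ ≡ k) B ×
  ((T : Subset v) → ∣ T ∣ ≡ t → count T B ≡ λ′)

IsSimpleDesign : (t v k λ′ : ℕ) → List (Subset v) → Set
IsSimpleDesign t v k λ′ B = IsDesign t v k λ′ B × Unique B

{-# OPTIONS --safe #-}

-- Take the points to be ℤ₅ × ℤ₁₁ and let the Frobenius group 11 : 5 act regularly on them,
-- generated by α : (i , x) ↦ (i + 1 , x) and τ : (i , x) ↦ (i , x + 4ⁱ); note 4 ^ 5 ≡ 1 (mod 11).
-- The 132 blocks are two regular orbits (55 + 55) and the orbits (11 + 11) of two α-invariant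
-- sets ℤ₅ × {a , b}. The group has 27 orbits on pairs of points; the base blocks were found by
-- a meet-in-the-middle search for two 10-sets whose pair-orbit counts, together with those of
-- the two short orbits, add up to 4 on every orbit. The balance condition is verified by
-- branching on whether the first point belongs to the t-subset: if not, delete the point from
-- all blocks; if so, pass to the derived structure of the blocks through it.

module Submission where

open import Defs
open import Data.Fin.Subset using (Subset)
open import Data.List using (List)
open import Data.Product using (∃)

open import Data.Bool using (true; false)
open import Data.Bool.ListAction using (any)
import Data.Bool.Properties as Bool
open import Data.Fin using (toℕ)
open import Data.Fin.Subset using (inside; outside; ∣_∣; _⊆_)
open import Data.Fin.Subset.Properties using (_⊆?_; out⊆)
open import Data.List using ([]; _∷_; _++_; cartesianProduct; cartesianProductWith; concatMap; length; map; upTo)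
open import Data.List.Properties using (filter-all)
open import Data.List.Relation.Unary.All using (all?; universal)
import Data.List.Relation.Unary.Unique.DecPropositional as UniqueDec
open import Data.Nat using (ℕ; zero; suc; _+_; _*_; _^_; _≡ᵇ_; _≟_)
open import Data.Nat.DivMod using (_%_)
open import Data.Nat.Properties using (suc-injective)
open import Data.Product using (_×_; _,_)
open import Data.Unit using (⊤; tt)
open import Data.Vec using (_∷_; []; tail; tabulate)
import Data.Vec.Properties as Vec
open import Relation.Binary.PropositionalEquality using (_≡_; refl; cong; trans)
open import Relation.Nullary.Decidable using (Dec; yes; does; toWitness; _×-dec_)

private
  variable
    v : ℕ

link : List (Subset (suc v)) → List (Subset v)
link []                  = []
link ((inside  ∷ b) ∷ B) = b ∷ link B
link ((outside ∷ b) ∷ B) = link B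

-- The case `⊤` is vacuous truth: `Fin 0` has no subset of size `suc t`.
Balanced : (t v l : ℕ) → List (Subset v) → Set
Balanced zero    v       l B = length B ≡ l
Balanced (suc t) zero    l B = ⊤
Balanced (suc t) (suc v) l B = Balanced (suc t) v l (map tail B) × Balanced t v l (link B)

balanced? : ∀ t v l (B : List (Subset v)) → Dec (Balanced t v l B)
balanced? zero    v       l B = length B ≟ l
balanced? (suc t) zero    l B = yes tt
balanced? (suc t) (suc v) l B = balanced? (suc t) v l (map tail B) ×-dec balanced? t v l (link B)

∣p∣≡0⇒p⊆q : (p q : Subset v) → ∣ p ∣ ≡ 0 → p ⊆ q
∣p∣≡0⇒p⊆q (outside ∷ p) (_ ∷ q) eq = out⊆ (∣p∣≡0⇒p⊆q p q eq)

count-∣T∣≡0 : (T : Subset v) (B : List (Subset v)) → ∣ T ∣ ≡ 0 → count T B ≡ length B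
count-∣T∣≡0 T B eq = cong length (filter-all (T ⊆?_) (universal {P = T ⊆_} (λ b → ∣p∣≡0⇒p⊆q T b eq) B))

count-outside : (T : Subset v) (B : List (Subset (suc v))) → count (outside ∷ T) B ≡ count T (map tail B)
count-outside T []            = refl
-- The Boolean of `outside ∷ T ⊆? _ ∷ b` reduces to this one, so a single split evaluates both
-- filters.
count-outside T ((_ ∷ b) ∷ B) with does (T ⊆? b)
... | true  = cong suc (count-outside T B)
... | false = count-outside T B

count-inside : (T : Subset v) (B : List (Subset (suc v))) → count (inside ∷ T) B ≡ count T (link B)
count-inside T []                  = refl
count-inside T ((outside ∷ b) ∷ B) = count-inside T B
count-inside T ((inside  ∷ b) ∷ B) with does (T ⊆? b)
... | true  = cong suc (count-inside T B)
... | false = count-inside T B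

balanced⇒count : ∀ t l (B : List (Subset v)) → Balanced t v l B →
                 (T : Subset v) → ∣ T ∣ ≡ t → count T B ≡ l
balanced⇒count zero    l B len       T             eq = trans (count-∣T∣≡0 T B eq) len
balanced⇒count (suc t) l B (del , _) (outside ∷ T) eq =
  trans (count-outside T B) (balanced⇒count (suc t) l (map tail B) del T eq)
balanced⇒count (suc t) l B (_ , lnk) (inside ∷ T)  eq =
  trans (count-inside T B) (balanced⇒count t l (link B) lnk T (suc-injective eq))

Point : Set
Point = ℕ × ℕ

-- `τ` acts first, hence the exponent is the old `i`. As `α` normalises the group generated by `τ`,
-- `j < 5` and `c < 11` give each group element once.
α^_τ^_ : ℕ → ℕ → Point → Point
(α^ j τ^ c) (i , x) = (i + j) % 5 , (x + c * 4 ^ i) % 11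

-- (i , x) is numbered 11 i + x.
fromPoints : List Point → Subset 55
fromPoints ps = tabulate λ n → any (λ (i , x) → 11 * i + x ≡ᵇ toℕ n) ps

fullOrbit : List Point → List (Subset 55)
fullOrbit ps = cartesianProductWith (λ j c → fromPoints (map (α^ j τ^ c) ps)) (upTo 5) (upTo 11)

-- `α` fixes the base set, so the powers of `τ` alone reach its whole orbit.
shortOrbit : List ℕ → List (Subset 55)
shortOrbit xs = map (λ c → fromPoints (map (α^ 0 τ^ c) (cartesianProduct (upTo 5) xs))) (upTo 11)

base₁ base₂ : List Point
base₁ = (1 , 0) ∷ (2 , 2) ∷ (2 , 7) ∷ (3 , 0) ∷ (3 , 3) ∷ (3 , 4) ∷ (4 , 0) ∷ (4 , 4) ∷ (4 , 7) ∷ (4 , 9) ∷ []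
base₂ = (1 , 3) ∷ (1 , 5) ∷ (1 , 10) ∷ (2 , 0) ∷ (2 , 1) ∷ (3 , 1) ∷ (3 , 9) ∷ (4 , 2) ∷ (4 , 4) ∷ (4 , 7) ∷ []

blocks : List (Subset 55)
blocks = concatMap fullOrbit (base₁ ∷ base₂ ∷ []) ++ concatMap shortOrbit ((0 ∷ 1 ∷ []) ∷ (2 ∷ 3 ∷ []) ∷ [])

theorem1 : ∃ λ (B : List (Subset 55)) → IsSimpleDesign 2 55 10 4 B
theorem1 = blocks ,
  ( toWitness {a? = all? (λ b → ∣ b ∣ ≟ 10) blocks} tt
  , balanced⇒count 2 4 blocks (toWitness {a? = balanced? 2 55 4 blocks} tt)
  ) , toWitness {a? = UniqueDec.unique? (Vec.≡-dec Bool._≟_) blocks} tt
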